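{- Let $R$ be a Dedekind domain and let $I$ be a nonzero ideal of $R$ such that $R/I$ is finite and nontrivial. Then $\omega(G_{R/I})=\chi(G_{R/I})=Q(I)$.
   Context: $G_{R/I}$ is the unitary Cayley graph of $R/I$: vertex set $R/I$, with $a+I$, $b+I$ adjacent iff $a-b+I$ is a unit of $R/I$. $\omega$ and $\chi$ denote clique number and chromatic number. $Q(I)$ is the minimum of $|R/P|$ over all prime ideals $P$ dividing $I$. -}

module Defs where

open import Level using (_⊔_) renaming (suc to lsuc)
open import Algebra.Bundles using (CommutativeRing)
open import Data.Nat using (ℕ; zero; suc; _≤_)
open import Data.Fin using (Fin; zero; suc)
open import Data.Product using (Σ; _×_; _,_)
open import Data.Sum using (_⊎_)
open import Data.List using (List; []; _∷_)
open import Data.List.Relation.Unary.All using (All)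
open import Relation.Nullary using (¬_)
open import Relation.Binary.PropositionalEquality using (_≡_)

module _ {c ℓ} (R : CommutativeRing c ℓ) where
  open CommutativeRing R using (_≈_; _+_; _*_; -_; 0#; 1#) renaming (Carrier to A)

  _⊖_ : A → A → A
  x ⊖ y = x + (- y)

  pow : A → ℕ → A
  pow x zero = 1#
  pow x (suc n) = x * pow x n

  sumFin : (n : ℕ) → (Fin n → A) → A
  sumFin zero f = 0#
  sumFin (suc n) f = f zero + sumFin n (λ i → f (suc i))

  record IsIdeal (I : A → Set (c ⊔ ℓ)) : Set (c ⊔ ℓ) where
    field
      resp : ∀ {x y} → x ≈ y → I x → I y
      zero∈ : I 0#
      +∈ : ∀ {x y} → I x → I y → I (x + y)
      *∈ : ∀ r {x} → I x → I (r * x)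

  record Ideal : Set (lsuc (c ⊔ ℓ)) where
    field
      mem : A → Set (c ⊔ ℓ)
      isIdeal : IsIdeal mem
  open Ideal public

  _⊆ᵢ_ : Ideal → Ideal → Set (c ⊔ ℓ)
  I ⊆ᵢ J = ∀ x → mem I x → mem J x

  Proper : Ideal → Set (c ⊔ ℓ)
  Proper I = ¬ mem I 1#

  NonzeroIdeal : Ideal → Set (c ⊔ ℓ)
  NonzeroIdeal I = Σ A λ x → mem I x × ¬ (x ≈ 0#)

  IsPrimeIdeal : Ideal → Set (c ⊔ ℓ)
  IsPrimeIdeal P = Proper P × (∀ a b → mem P (a * b) → mem P a ⊎ mem P b)

  IsMaximalIdeal : Ideal → Set (lsuc (c ⊔ ℓ))
  IsMaximalIdeal P = Proper P × (∀ J → P ⊆ᵢ J → (J ⊆ᵢ P) ⊎ mem J 1#)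

  sumProds : List (A × A) → A
  sumProds [] = 0#
  sumProds ((p , q) ∷ ps) = p * q + sumProds ps

  ProdMem : Ideal → Ideal → A → Set (c ⊔ ℓ)
  ProdMem I J x = Σ (List (A × A)) λ ps →
    All (λ pq → mem I (Data.Product.proj₁ pq) × mem J (Data.Product.proj₂ pq)) ps
    × x ≈ sumProds ps

  Divides : Ideal → Ideal → Set (lsuc (c ⊔ ℓ))
  Divides P I = Σ Ideal λ J → (∀ x → mem I x → ProdMem P J x) × (∀ x → ProdMem P J x → mem I x)

  IsDomain : Set (c ⊔ ℓ)
  IsDomain = ¬ (1# ≈ 0#) × (∀ a b → a * b ≈ 0# → a ≈ 0# ⊎ b ≈ 0#)

  FinitelyGenerated : Ideal → Set (c ⊔ ℓ)
  FinitelyGenerated I = Σ ℕ λ n → Σ (Fin n → A) λ g →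
    (∀ i → mem I (g i)) ×
    (∀ x → mem I x → Σ (Fin n → A) λ r → x ≈ sumFin n (λ i → r i * g i))

  IsNoetherian : Set (lsuc (c ⊔ ℓ))
  IsNoetherian = ∀ (I : Ideal) → FinitelyGenerated I

  -- the fraction a/b (b ≠ 0) is integral over R: a^n + Σ_{i<n} r_i a^i b^(n-i) = 0
  IntegralFraction : A → A → Set (c ⊔ ℓ)
  IntegralFraction a b = Σ ℕ λ n → Σ (Fin n → A) λ r →
    pow a n + sumFin n (λ i → r i * (pow a (Data.Fin.toℕ i) * pow b (n Data.Nat.∸ Data.Fin.toℕ i))) ≈ 0#

  IsIntegrallyClosed : Set (c ⊔ ℓ)
  IsIntegrallyClosed = ∀ a b → ¬ (b ≈ 0#) → IntegralFraction a b → Σ A λ r → a ≈ b * r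

  IsDedekindDomain : Set (lsuc (c ⊔ ℓ))
  IsDedekindDomain = IsDomain × IsNoetherian × IsIntegrallyClosed ×
    (∀ P → IsPrimeIdeal P → NonzeroIdeal P → IsMaximalIdeal P)

  -- the quotient R/I, as R with congruence mod I
  _≡[_]_ : A → Ideal → A → Set (c ⊔ ℓ)
  a ≡[ I ] b = mem I (a ⊖ b)

  HasSize : Ideal → ℕ → Set (c ⊔ ℓ)
  HasSize I n = Σ (Fin n → A) λ f →
    (∀ x → Σ (Fin n) λ i → x ≡[ I ] f i) × (∀ i j → f i ≡[ I ] f j → i ≡ j)

  FiniteQuotient : Ideal → Set (c ⊔ ℓ)
  FiniteQuotient I = Σ ℕ λ n → HasSize I n

  NontrivialQuotient : Ideal → Set (c ⊔ ℓ)
  NontrivialQuotient I = ¬ (1# ≡[ I ] 0#)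

  IsUnitMod : Ideal → A → Set (c ⊔ ℓ)
  IsUnitMod I x = Σ A λ y → (x * y) ≡[ I ] 1#

  Adj : Ideal → A → A → Set (c ⊔ ℓ)
  Adj I a b = IsUnitMod I (a ⊖ b)

  HasClique : Ideal → ℕ → Set (c ⊔ ℓ)
  HasClique I k = Σ (Fin k → A) λ f → ∀ i j → ¬ (i ≡ j) →
    ¬ (f i ≡[ I ] f j) × Adj I (f i) (f j)

  CliqueNumber : Ideal → ℕ → Set (c ⊔ ℓ)
  CliqueNumber I k = HasClique I k × (∀ m → HasClique I m → m ≤ k)

  HasColouring : Ideal → ℕ → Set (c ⊔ ℓ)
  HasColouring I k = Σ (A → Fin k) λ col →
    (∀ a b → a ≡[ I ] b → col a ≡ col b) × (∀ a b → Adj I a b → ¬ (col a ≡ col b))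

  ChromaticNumber : Ideal → ℕ → Set (c ⊔ ℓ)
  ChromaticNumber I k = HasColouring I k × (∀ m → HasColouring I m → k ≤ m)

  IsQ : Ideal → ℕ → Set (lsuc (c ⊔ ℓ))
  IsQ I q = (Σ Ideal λ P → IsPrimeIdeal P × Divides P I × HasSize P q)
    × (∀ P m → IsPrimeIdeal P → Divides P I → HasSize P m → q ≤ m)

{-# OPTIONS --safe #-}
module Submission where

-- A prime P over I colours G_{R/I} by residues modulo P, so cliques have at
-- most |R/P| vertices; it remains to find a clique of size q, the least such
-- |R/P|.  Build it one vertex at a time: fewer than q vertices leave a free
-- residue class modulo every prime over I, the Chinese remainder theorem gives
-- a common x outside the occupied classes modulo all of them, and an element
-- outside every prime over I is a unit modulo I.
--
-- Two facts about the Dedekind domain enter.  Every prime over I ≠ 0 is a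
-- colon ideal (I : y), so only finitely many occur when R/I is finite.  And a
-- prime P ⊇ I divides I: with 0 ≠ a ∈ P and P = (a : b), integral closedness
-- shows that b / a does not stabilise P, which makes P invertible.
--
-- Noetherianity is stated for ideals given by arbitrary predicates, which
-- makes it strong enough to yield excluded middle, and hence classical
-- reasoning, in the universe of the ideals.

open import Defs
open import Algebra.Bundles using (CommutativeRing)
open import Data.Nat using (ℕ)
open import Data.Product using (Σ; _×_)

open import Level using (_⊔_; Lift; lift)
open import Algebra.Properties.Ring using (-1*x≈-x; -‿distribˡ-*; x∙y⁻¹≈ε⇒x≈y; x≈y⇒x∙y⁻¹≈ε; ⁻¹-anti-homo-//; x[y-z]≈xy-xz; [y-z]x≈yx-zx)
open import Algebra.Solver.Ring.NaturalCoefficients.Default as NaturalCoefficients using ()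
open import Data.Empty using (⊥-elim)
open import Data.Fin using (Fin; zero; suc; toℕ)
open import Data.Fin.Properties using (injective⇒≤; toℕ≤n; _≟_)
open import Data.List using (allFin; []; _∷_)
open import Data.List.Extrema.Nat using (argmin; f[argmin]≤f[xs])
open import Data.List.Membership.Propositional.Properties using (∈-allFin)
open import Data.List.Relation.Unary.All using (All; []; _∷_; lookup)
open import Data.Nat using (zero; suc; _≤_; _<_; _≤′_; ≤′-refl; ≤′-step; _∸_) renaming (_⊔_ to _⊔ℕ_; _+_ to _+ℕ_)
open import Data.Nat.Properties using (≤-refl; ≤-trans; <⇒≤; <⇒≱; ≤⇒≤′; m≤m⊔n; m≤n⊔m; m∸n+n≡m)
open import Data.Product using (_,_; proj₁; proj₂)
open import Data.Sum using (_⊎_; inj₁; inj₂; [_,_]′)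
open import Function using (_∘_)
open import Relation.Nullary using (¬_; Dec; yes; no)
open import Relation.Nullary.Decidable using (decidable-stable)
import Relation.Binary.PropositionalEquality as ≡
open ≡ using (_≡_)

module RingLemmas {c ℓ} (R : CommutativeRing c ℓ) where
  open CommutativeRing R hiding (zero) renaming (Carrier to A)
  open import Relation.Binary.Reasoning.Setoid setoid
  open NaturalCoefficients commutativeSemiring using (solve; _:=_; _:+_; _:*_)
  open IsIdeal

  infix 4 _∈_ _⊆_
  _∈_ : A → Ideal R → Set (c ⊔ ℓ)
  x ∈ J = mem J x

  _⊆_ : Ideal R → Ideal R → Set (c ⊔ ℓ)
  _⊆_ = _⊆ᵢ_ R

  -- Congruence modulo an ideal

  neg∈ : ∀ J {x} → x ∈ J → - x ∈ J
  neg∈ J {x} x∈ = resp (isIdeal J) (-1*x≈-x ring x) (*∈ (isIdeal J) (- 1#) x∈)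

  ∈-swap : ∀ J {x y} → x - y ∈ J → y - x ∈ J
  ∈-swap J {x} {y} h = resp (isIdeal J) (⁻¹-anti-homo-// ring x y) (neg∈ J h)

  telescope : ∀ x y z → (x - y) + (y - z) ≈ x - z
  telescope x y z = begin
    (x - y) + (y - z)    ≈⟨ solve 4 (λ x y -y -z → (x :+ -y) :+ (y :+ -z) := (y :+ -y) :+ (x :+ -z)) refl x y (- y) (- z) ⟩
    (y - y) + (x - z)    ≈⟨ +-congʳ (-‿inverseʳ y) ⟩
    0# + (x - z)         ≈⟨ +-identityˡ _ ⟩
    x - z                ∎

  ∈-trans : ∀ J {x y z} → x - y ∈ J → y - z ∈ J → x - z ∈ J
  ∈-trans J {x} {y} {z} h k = resp (isIdeal J) (telescope x y z) (+∈ (isIdeal J) h k)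

  ∈-refl : ∀ J {x} → x - x ∈ J
  ∈-refl J {x} = resp (isIdeal J) (sym (-‿inverseʳ x)) (zero∈ (isIdeal J))

  ∈-absorb : ∀ J {x y} → x - y ∈ J → y ∈ J → x ∈ J
  ∈-absorb J {x} {y} h k = resp (isIdeal J) (trans (+-assoc x (- y) y) (trans (+-congˡ (-‿inverseˡ y)) (+-identityʳ x)))
    (+∈ (isIdeal J) h k)

  ≈sum⇒diff≈ : ∀ {x y z} → x ≈ y + z → x - y ≈ z
  ≈sum⇒diff≈ {x} {y} {z} h = begin
    x - y          ≈⟨ +-congʳ h ⟩
    (y + z) - y    ≈⟨ solve 3 (λ y z -y → (y :+ z) :+ -y := (y :+ -y) :+ z) refl y z (- y) ⟩
    (y - y) + z    ≈⟨ +-congʳ (-‿inverseʳ y) ⟩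
    0# + z         ≈⟨ +-identityˡ z ⟩
    z              ∎

  -- Chinese remainder formula: `p * x + w * z` is `x` modulo `w` and, with the roles exchanged, `z`
  -- modulo `p`.
  interpolation-diff : ∀ {p w} → 1# ≈ p + w → ∀ x z → (p * x + w * z) - x ≈ w * (z - x)
  interpolation-diff {p} {w} h x z = begin
    (p * x + w * z) - x               ≈⟨ +-congˡ (-‿cong (trans (sym (*-identityˡ x)) (*-congʳ h))) ⟩
    (p * x + w * z) - (p + w) * x     ≈⟨ ≈sum⇒diff≈ (begin
      p * x + w * z                   ≈⟨ +-congˡ (*-congˡ (sym zx+x)) ⟩
      p * x + w * ((z - x) + x)       ≈⟨ solve 4 (λ p w x d → p :* x :+ w :* (d :+ x) := (p :+ w) :* x :+ w :* d) refl p w x (z - x) ⟩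
      (p + w) * x + w * (z - x)       ∎) ⟩
    w * (z - x)                       ∎
    where
    zx+x : (z - x) + x ≈ z
    zx+x = trans (+-assoc z (- x) x) (trans (+-congˡ (-‿inverseˡ x)) (+-identityʳ z))

  -- Finite sums and powers

  sumFin-cong : ∀ n {f g : Fin n → A} → (∀ i → f i ≈ g i) → sumFin R n f ≈ sumFin R n g
  sumFin-cong zero    h = refl
  sumFin-cong (suc n) h = +-cong (h zero) (sumFin-cong n (h ∘ suc))

  sumFin-0 : ∀ n {f : Fin n → A} → (∀ i → f i ≈ 0#) → sumFin R n f ≈ 0#
  sumFin-0 zero    h = refl
  sumFin-0 (suc n) h = trans (+-cong (h zero) (sumFin-0 n (h ∘ suc))) (+-identityˡ 0#)

  sumFin-+ : ∀ n (f g : Fin n → A) → sumFin R n (λ i → f i + g i) ≈ sumFin R n f + sumFin R n g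
  sumFin-+ zero    f g = sym (+-identityˡ 0#)
  sumFin-+ (suc n) f g = trans (+-congˡ (sumFin-+ n (f ∘ suc) (g ∘ suc)))
    (solve 4 (λ a b s t → (a :+ b) :+ (s :+ t) := (a :+ s) :+ (b :+ t)) refl (f zero) (g zero) _ _)

  sumFin-*ˡ : ∀ n r (f : Fin n → A) → r * sumFin R n f ≈ sumFin R n (λ i → r * f i)
  sumFin-*ˡ zero    r f = zeroʳ r
  sumFin-*ˡ (suc n) r f = trans (distribˡ r _ _) (+-congˡ (sumFin-*ˡ n r (f ∘ suc)))

  sumFin-∈ : ∀ J n {f : Fin n → A} → (∀ i → f i ∈ J) → sumFin R n f ∈ J
  sumFin-∈ J zero    h = zero∈ (isIdeal J)
  sumFin-∈ J (suc n) h = +∈ (isIdeal J) (h zero) (sumFin-∈ J n (h ∘ suc))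

  pow-+ : ∀ x m n → pow R x (m +ℕ n) ≈ pow R x m * pow R x n
  pow-+ x zero    n = sym (*-identityˡ _)
  pow-+ x (suc m) n = trans (*-congˡ (pow-+ x m n)) (sym (*-assoc _ _ _))

  -- Principal, adjoined, colon and spanned ideals

  principal : A → Ideal R
  principal a = record
    { mem = λ x → Σ A λ r → x ≈ r * a
    ; isIdeal = record
      { resp = λ { x≈y (r , h) → r , trans (sym x≈y) h }
      ; zero∈ = 0# , sym (zeroˡ a)
      ; +∈ = λ { (r , h) (s , k) → r + s , trans (+-cong h k) (sym (distribʳ a r s)) }
      ; *∈ = λ { s (r , h) → s * r , trans (*-congˡ h) (sym (*-assoc s r a)) }
      } }

  adjoin : Ideal R → A → Ideal R
  adjoin I a = record
    { mem = λ x → Σ A λ i → Σ A λ r → i ∈ I × x ≈ i + r * a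
    ; isIdeal = record
      { resp = λ { x≈y (i , r , i∈ , h) → i , r , i∈ , trans (sym x≈y) h }
      ; zero∈ = 0# , 0# , zero∈ (isIdeal I) , sym (trans (+-congˡ (zeroˡ a)) (+-identityˡ 0#))
      ; +∈ = λ { (i , r , i∈ , h) (j , s , j∈ , k) → i + j , r + s , +∈ (isIdeal I) i∈ j∈ ,
          trans (+-cong h k) (solve 5 (λ i r j s a → (i :+ r :* a) :+ (j :+ s :* a) := (i :+ j) :+ (r :+ s) :* a) refl i r j s a) }
      ; *∈ = λ { s (i , r , i∈ , h) → s * i , s * r , *∈ (isIdeal I) s i∈ ,
          trans (*-congˡ h) (solve 4 (λ s i r a → s :* (i :+ r :* a) := s :* i :+ (s :* r) :* a) refl s i r a) }
      } }

  ⊆adjoin : ∀ I a → I ⊆ adjoin I a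
  ⊆adjoin I a x x∈ = x , 0# , x∈ , sym (trans (+-congˡ (zeroˡ a)) (+-identityʳ x))

  ∈adjoin : ∀ I a → a ∈ adjoin I a
  ∈adjoin I a = 0# , 1# , zero∈ (isIdeal I) , sym (trans (+-identityˡ _) (*-identityˡ a))

  colon : Ideal R → A → Ideal R
  colon I y = record
    { mem = λ x → x * y ∈ I
    ; isIdeal = record
      { resp = λ x≈x′ → resp (isIdeal I) (*-congʳ x≈x′)
      ; zero∈ = resp (isIdeal I) (sym (zeroˡ y)) (zero∈ (isIdeal I))
      ; +∈ = λ h k → resp (isIdeal I) (sym (distribʳ y _ _)) (+∈ (isIdeal I) h k)
      ; *∈ = λ r h → resp (isIdeal I) (sym (*-assoc r _ y)) (*∈ (isIdeal I) r h)
      } }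

  ⊆colon : ∀ I y → I ⊆ colon I y
  ⊆colon I y x x∈ = resp (isIdeal I) (*-comm y x) (*∈ (isIdeal I) y x∈)

  colon-cong : ∀ I {y y′} → y - y′ ∈ I → colon I y ⊆ colon I y′
  colon-cong I {y} {y′} h x xy∈ = ∈-absorb I
    (resp (isIdeal I) (x[y-z]≈xy-xz ring x y′ y) (*∈ (isIdeal I) x (∈-swap I h))) xy∈

  colonIdeal : Ideal R → Ideal R → Ideal R
  colonIdeal I P = record
    { mem = λ x → ∀ p → p ∈ P → p * x ∈ I
    ; isIdeal = record
      { resp = λ x≈y h p p∈ → resp (isIdeal I) (*-congˡ x≈y) (h p p∈)
      ; zero∈ = λ p _ → resp (isIdeal I) (sym (zeroʳ p)) (zero∈ (isIdeal I))
      ; +∈ = λ h k p p∈ → resp (isIdeal I) (sym (distribˡ p _ _)) (+∈ (isIdeal I) (h p p∈) (k p p∈))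
      ; *∈ = λ r {x} h p p∈ → resp (isIdeal I)
          (solve 3 (λ r p x → r :* (p :* x) := p :* (r :* x)) refl r p x) (*∈ (isIdeal I) r (h p p∈))
      } }

  span : (ℕ → A) → ℕ → Ideal R
  span s n = record
    { mem = λ x → Σ (Fin n → A) λ r → x ≈ sumFin R n (λ i → r i * s (toℕ i))
    ; isIdeal = record
      { resp = λ { x≈y (r , h) → r , trans (sym x≈y) h }
      ; zero∈ = (λ _ → 0#) , sym (sumFin-0 n (λ i → zeroˡ _))
      ; +∈ = λ { (r , h) (t , k) → (λ i → r i + t i) ,
          trans (+-cong h k) (trans (sym (sumFin-+ n _ _)) (sumFin-cong n (λ i → sym (distribʳ _ (r i) (t i))))) }
      ; *∈ = λ { t (r , h) → (λ i → t * r i) ,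
          trans (*-congˡ h) (trans (sumFin-*ˡ n t _) (sumFin-cong n (λ i → sym (*-assoc t (r i) _)))) }
      } }

  -- `sumFin` unfolds at its first index while the new generator comes last, so the recursion shifts
  -- the sequence.
  span-snoc : ∀ s n {x} → x ∈ span s n → ∀ t → x + t * s n ∈ span s (suc n)
  span-snoc s zero    (r , h) t = (λ _ → t) , trans (+-congʳ h) (+-comm 0# _)
  span-snoc s (suc n) (r , h) t with span-snoc (s ∘ suc) n (r ∘ suc , refl) t
  ... | r′ , h′ = (λ { zero → r zero ; (suc i) → r′ i }) ,
    trans (+-congʳ h) (trans (+-assoc _ _ _) (+-congˡ h′))

  span-mono : ∀ s n → span s n ⊆ span s (suc n)
  span-mono s n x x∈ = resp (isIdeal (span s (suc n))) (trans (+-congˡ (zeroˡ _)) (+-identityʳ x)) (span-snoc s n x∈ 0#)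

  ∈span : ∀ s n → s n ∈ span s (suc n)
  ∈span s n = resp (isIdeal (span s (suc n))) (trans (+-identityˡ _) (*-identityˡ _))
    (span-snoc s n (zero∈ (isIdeal (span s n))) 1#)

  -- Prime and maximal ideals, colourings and cliques

  maximal-comax : ∀ P → IsMaximalIdeal R P → ∀ {t} → ¬ t ∈ P → 1# ∈ adjoin P t
  maximal-comax P (_ , max) {t} t∉ with max (adjoin P t) (⊆adjoin P t)
  ... | inj₁ h = ⊥-elim (t∉ (h t (∈adjoin P t)))
  ... | inj₂ h = h

  divides⇒⊇ : ∀ P I → Divides R P I → I ⊆ P
  divides⇒⊇ P I (J , I⊆PJ , _) x x∈ with I⊆PJ x x∈
  ... | ps , all , h = resp (isIdeal P) (sym h) (go ps all)
    where
    go : ∀ ps → All (λ pq → proj₁ pq ∈ P × proj₂ pq ∈ J) ps → sumProds R ps ∈ P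
    go []             []             = zero∈ (isIdeal P)
    go ((p , q) ∷ ps) ((p∈ , _) ∷ a) = +∈ (isIdeal P) (resp (isIdeal P) (*-comm q p) (*∈ (isIdeal P) q p∈)) (go ps a)

  -- The colours are the residue classes modulo `P`: a unit modulo `I` lying in `P` would put 1 into
  -- `P`.
  prime⇒colouring : ∀ P I → IsPrimeIdeal R P → I ⊆ P → ∀ {m} → HasSize R P m → HasColouring R I m
  prime⇒colouring P I (proper , _) I⊆P (f , cover , inj) =
    (λ x → proj₁ (cover x)) ,
    (λ a b h → inj _ _ (class-eq a b (I⊆P _ h))) ,
    (λ { a b (y , h) eq → proper (∈-absorb P (∈-swap P (I⊆P _ h))
          (resp (isIdeal P) (*-comm y _) (*∈ (isIdeal P) y (same-class a b eq)))) })
    where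
    class-eq : ∀ a b → a - b ∈ P → f (proj₁ (cover a)) - f (proj₁ (cover b)) ∈ P
    class-eq a b h = ∈-trans P (∈-swap P (proj₂ (cover a))) (∈-trans P h (proj₂ (cover b)))
    same-class : ∀ a b → proj₁ (cover a) ≡ proj₁ (cover b) → a - b ∈ P
    same-class a b eq = ∈-trans P (proj₂ (cover a))
      (≡.subst (λ i → f i - b ∈ P) (≡.sym eq) (∈-swap P (proj₂ (cover b))))

  -- A colouring is injective on a clique.
  clique≤colouring : ∀ I {m k} → HasClique R I m → HasColouring R I k → m ≤ k
  clique≤colouring I (f , adjacent) (colour , _ , separates) = injective⇒≤ {f = colour ∘ f}
    λ {i} {j} eq → decidable-stable (i ≟ j) λ i≢j → separates (f i) (f j) (proj₂ (adjacent i j i≢j)) eq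

-- Noetherian domains: excluded middle and ascending chains

module NoetherianDomain {c ℓ} (R : CommutativeRing c ℓ) (domain : IsDomain R) (noetherian : IsNoetherian R) where
  open CommutativeRing R hiding (zero) renaming (Carrier to A)
  open RingLemmas R
  open import Relation.Binary.Reasoning.Setoid setoid
  open NaturalCoefficients commutativeSemiring using (solve; _:=_; _:*_)
  open IsIdeal

  *-cancelʳ : ∀ {x y z} → ¬ z ≈ 0# → x * z ≈ y * z → x ≈ y
  *-cancelʳ {x} {y} {z} z≉0 h with proj₂ domain (x - y) z (trans ([y-z]x≈yx-zx ring z x y) (x≈y⇒x∙y⁻¹≈ε ring h))
  ... | inj₁ x-y≈0 = x∙y⁻¹≈ε⇒x≈y ring x y x-y≈0
  ... | inj₂ z≈0   = ⊥-elim (z≉0 z≈0)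

  -- The subset {x | x ≈ 0 or X} is an ideal, and inspecting a finite
  -- list of its generators decides X.
  excluded-middle : (X : Set (c ⊔ ℓ)) → Dec X
  excluded-middle X with noetherian J
    where
    J : Ideal R
    J = record
      { mem = λ x → x ≈ 0# ⊎ X
      ; isIdeal = record
        { resp = λ { x≈y (inj₁ h) → inj₁ (trans (sym x≈y) h) ; _ (inj₂ p) → inj₂ p }
        ; zero∈ = inj₁ refl
        ; +∈ = λ { (inj₁ h) (inj₁ k) → inj₁ (trans (+-cong h k) (+-identityˡ 0#)) ; (inj₂ p) _ → inj₂ p ; _ (inj₂ p) → inj₂ p }
        ; *∈ = λ { r (inj₁ h) → inj₁ (trans (*-congˡ h) (zeroʳ r)) ; _ (inj₂ p) → inj₂ p }
        } }
  ... | n , g , g∈ , generates with all-zero? n g g∈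
    where
    all-zero? : ∀ n (g : Fin n → A) → (∀ i → g i ≈ 0# ⊎ X) → (∀ i → g i ≈ 0#) ⊎ X
    all-zero? zero    g h = inj₁ λ ()
    all-zero? (suc n) g h with h zero | all-zero? n (g ∘ suc) (h ∘ suc)
    ... | inj₂ x | _      = inj₂ x
    ... | inj₁ _ | inj₂ x = inj₂ x
    ... | inj₁ z | inj₁ k = inj₁ λ { zero → z ; (suc i) → k i }
  ... | inj₂ x = yes x
  ... | inj₁ z = no λ x → let r , h = generates 1# (inj₂ x) in
    proj₁ domain (trans h (sumFin-0 n (λ i → trans (*-congˡ (z i)) (zeroʳ (r i)))))

  stable : ∀ {X : Set (c ⊔ ℓ)} → ¬ ¬ X → X
  stable {X} = decidable-stable (excluded-middle X)

  module _ (J : ℕ → Ideal R) (mono : ∀ n → J n ⊆ J (suc n)) where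
    chain-mono : ∀ {m n} → m ≤′ n → J m ⊆ J n
    chain-mono ≤′-refl     x x∈ = x∈
    chain-mono (≤′-step h) x x∈ = mono _ x (chain-mono h x x∈)

    chain-mono-≤ : ∀ {m n} → m ≤ n → J m ⊆ J n
    chain-mono-≤ m≤n = chain-mono (≤⇒≤′ m≤n)

    ⋃chain : Ideal R
    ⋃chain = record
      { mem = λ x → Σ ℕ λ n → x ∈ J n
      ; isIdeal = record
        { resp = λ { x≈y (n , h) → n , resp (isIdeal (J n)) x≈y h }
        ; zero∈ = 0 , zero∈ (isIdeal (J 0))
        ; +∈ = λ { {x} {y} (m , h) (n , k) → m ⊔ℕ n , +∈ (isIdeal (J (m ⊔ℕ n)))
            (chain-mono-≤ (m≤m⊔n m n) x h) (chain-mono-≤ (m≤n⊔m m n) y k) }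
        ; *∈ = λ { r (n , h) → n , *∈ (isIdeal (J n)) r h }
        } }

    common-stage : ∀ k (g : Fin k → A) → (∀ i → g i ∈ ⋃chain) → Σ ℕ λ n → ∀ i → g i ∈ J n
    common-stage zero    g h = 0 , λ ()
    common-stage (suc k) g h with h zero | common-stage k (g ∘ suc) (h ∘ suc)
    ... | m , h₀ | n , hₛ = m ⊔ℕ n , λ
      { zero    → chain-mono-≤ (m≤m⊔n m n) _ h₀
      ; (suc i) → chain-mono-≤ (m≤n⊔m m n) _ (hₛ i) }

    -- The union of the chain has finitely many generators, and these all lie in one stage.
    chain-stabilises : Σ ℕ λ n → J (suc n) ⊆ J n
    chain-stabilises with noetherian ⋃chain
    ... | k , g , g∈ , generates with common-stage k g g∈
    ... | n , g∈Jn = n , λ x x∈ → let r , h = generates x (suc n , x∈) in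
      resp (isIdeal (J n)) (sym h) (sumFin-∈ (J n) k (λ i → *∈ (isIdeal (J n)) (r i) (g∈Jn i)))

  -- Without a maximal member, a strictly larger one could be picked forever. The family has a small
  -- index type because excluded middle is at hand only in that universe, and ideals themselves live
  -- one level higher.
  maximal-member : (X : Set (c ⊔ ℓ)) → X → (J : X → Ideal R) →
    Σ X λ m → ∀ x → J m ⊆ J x → J x ⊆ J m
  maximal-member X x₀ J with excluded-middle (Σ X λ m → ∀ x → J m ⊆ J x → J x ⊆ J m)
  ... | yes m = m
  ... | no none = ⊥-elim (proj₂ (proj₂ (larger (chain (proj₁ stabilises)))) (proj₂ stabilises))
    where
    larger : ∀ x → Σ X λ y → J x ⊆ J y × ¬ J y ⊆ J x
    larger x = stable λ h → none (x , λ y x⊆y → stable λ y⊈x → h (y , x⊆y , y⊈x))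
    chain : ℕ → X
    chain zero    = x₀
    chain (suc k) = proj₁ (larger (chain k))
    stabilises : Σ ℕ λ k → J (chain (suc k)) ⊆ J (chain k)
    stabilises = chain-stabilises (J ∘ chain) (λ k → proj₁ (proj₂ (larger (chain k))))

  -- For y maximising (I : y) among the colon ideals disjoint from S,
  -- (I : y) is prime: if a b ∈ (I : y), then either (I : a y) is still
  -- disjoint from S, hence equal to (I : y) and contains b, or some t ∈ S
  -- lies in it, and then (I : t y) is equal to (I : y) and contains a.
  prime-colon-avoiding : ∀ I (S : A → Set (c ⊔ ℓ)) → S 1# → (∀ s t → S s → S t → S (s * t)) →
    (∀ s → S s → ¬ s ∈ I) → Σ A λ y → IsPrimeIdeal R (colon I y) × (∀ s → S s → ¬ s ∈ colon I y)
  prime-colon-avoiding I S S1 S* S∌I = y , (disjoint 1# S1 , prime) , disjoint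
    where
    Disjoint : A → Set (c ⊔ ℓ)
    Disjoint y = ∀ s → S s → ¬ s ∈ colon I y
    max : Σ (Σ A Disjoint) λ m → ∀ x → colon I (proj₁ m) ⊆ colon I (proj₁ x) → colon I (proj₁ x) ⊆ colon I (proj₁ m)
    max = maximal-member (Σ A Disjoint) (1# , λ s Ss h → S∌I s Ss (resp (isIdeal I) (*-identityʳ s) h)) (colon I ∘ proj₁)
    y : A
    y = proj₁ (proj₁ max)
    disjoint : Disjoint y
    disjoint = proj₂ (proj₁ max)
    larger-colon : ∀ t → colon I y ⊆ colon I (t * y)
    larger-colon t x h = resp (isIdeal I) (solve 3 (λ t x y → t :* (x :* y) := x :* (t :* y)) refl t x y) (*∈ (isIdeal I) t h)
    prime : ∀ a b → a * b ∈ colon I y → a ∈ colon I y ⊎ b ∈ colon I y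
    prime a b ab∈ with excluded-middle (Σ A λ t → S t × t ∈ colon I (a * y))
    ... | no avoids = inj₂ (proj₂ max (a * y , λ s Ss h → avoids (s , Ss , h)) (larger-colon a) b
      (resp (isIdeal I) (solve 3 (λ a b y → (a :* b) :* y := b :* (a :* y)) refl a b y) ab∈))
    ... | yes (t , St , h) = inj₁ (proj₂ max
      (t * y , λ s Ss k → disjoint (s * t) (S* s t Ss St) (resp (isIdeal I) (sym (*-assoc s t y)) k))
      (larger-colon t) a
      (resp (isIdeal I) (solve 3 (λ a t y → t :* (a :* y) := a :* (t :* y)) refl a t y) h))

  -- Take the multiplicative set {1}: an ideal avoids it exactly when it is proper.
  prime-colon : ∀ I → Proper R I → Σ A λ y → IsPrimeIdeal R (colon I y)
  prime-colon I proper with prime-colon-avoiding I (λ s → Lift c (s ≈ 1#)) (lift refl)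
    (λ { s t (lift h) (lift k) → lift (trans (*-cong h k) (*-identityˡ 1#)) })
    (λ { s (lift h) s∈ → proper (resp (isIdeal I) h s∈) })
  ... | y , prime , _ = y , prime

  -- If b P ⊆ a P, then any nonzero s 0 in P starts a sequence in P with
  -- b · s n ≈ a · s (n + 1), so s n = (b / a)ⁿ s 0.  A relation expressing
  -- s n through its predecessors is an integral equation for b / a.
  stable-multiplier⇒integral : ∀ P → NonzeroIdeal R P → ∀ a b →
    (∀ x → x ∈ P → Σ A λ y → y ∈ P × x * b ≈ y * a) → IntegralFraction R b a
  -- Multiplying by `p` turns each `pow R b i * p` into `pow R a i * s i`, so all terms share the
  -- factor `pow R a N` and the relation for `s N` cancels them.
  stable-multiplier⇒integral P (p , p∈ , p≉0) a b step = N , (λ i → - r i) , *-cancelʳ p≉0 (begin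
    (pow R b N + sumFin R N (λ i → - r i * (pow R b (toℕ i) * pow R a (N ∸ toℕ i)))) * p
      ≈⟨ distribʳ p _ _ ⟩
    pow R b N * p + sumFin R N (λ i → - r i * (pow R b (toℕ i) * pow R a (N ∸ toℕ i))) * p
      ≈⟨ +-cong (power N) (trans (*-comm _ p) (sumFin-*ˡ N p _)) ⟩
    pow R a N * s N + sumFin R N (λ i → p * (- r i * (pow R b (toℕ i) * pow R a (N ∸ toℕ i))))
      ≈⟨ +-cong (trans (*-congˡ (proj₂ relation)) (sumFin-*ˡ N _ _)) (sumFin-cong N term) ⟩
    sumFin R N (λ i → pow R a N * (r i * s (toℕ i))) + sumFin R N (λ i → - (pow R a N * (r i * s (toℕ i))))
      ≈⟨ sumFin-+ N _ _ ⟨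
    sumFin R N (λ i → pow R a N * (r i * s (toℕ i)) - pow R a N * (r i * s (toℕ i)))
      ≈⟨ sumFin-0 N (λ i → -‿inverseʳ _) ⟩
    0#
      ≈⟨ zeroˡ p ⟨
    0# * p ∎)
    where
    orbit : ℕ → Σ A (_∈ P)
    orbit zero    = p , p∈
    orbit (suc n) = let x , x∈ = orbit n ; y , y∈ , _ = step x x∈ in y , y∈
    s : ℕ → A
    s n = proj₁ (orbit n)
    power : ∀ n → pow R b n * p ≈ pow R a n * s n
    power zero    = refl
    power (suc n) = begin
      b * pow R b n * p           ≈⟨ *-assoc b _ p ⟩
      b * (pow R b n * p)         ≈⟨ *-congˡ (power n) ⟩
      b * (pow R a n * s n)       ≈⟨ solve 3 (λ b q s → b :* (q :* s) := q :* (s :* b)) refl b _ (s n) ⟩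
      pow R a n * (s n * b)       ≈⟨ *-congˡ (proj₂ (proj₂ (step (s n) (proj₂ (orbit n))))) ⟩
      pow R a n * (s (suc n) * a) ≈⟨ solve 3 (λ a q s → q :* (s :* a) := a :* q :* s) refl a _ (s (suc n)) ⟩
      a * pow R a n * s (suc n)   ∎
    stabilises : Σ ℕ λ n → span s (suc n) ⊆ span s n
    stabilises = chain-stabilises (span s) (span-mono s)
    N : ℕ
    N = proj₁ stabilises
    relation : s N ∈ span s N
    relation = proj₂ stabilises (s N) (∈span s N)
    r : Fin N → A
    r = proj₁ relation
    term : ∀ i → p * (- r i * (pow R b (toℕ i) * pow R a (N ∸ toℕ i))) ≈ - (pow R a N * (r i * s (toℕ i)))
    term i = begin
      p * (- r i * (pow R b (toℕ i) * pow R a (N ∸ toℕ i)))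
        ≈⟨ solve 4 (λ p r x y → p :* (r :* (x :* y)) := r :* (y :* (x :* p))) refl p (- r i) _ _ ⟩
      - r i * (pow R a (N ∸ toℕ i) * (pow R b (toℕ i) * p))
        ≈⟨ *-congˡ (*-congˡ (power (toℕ i))) ⟩
      - r i * (pow R a (N ∸ toℕ i) * (pow R a (toℕ i) * s (toℕ i)))
        ≈⟨ *-congˡ (*-assoc _ _ _) ⟨
      - r i * (pow R a (N ∸ toℕ i) * pow R a (toℕ i) * s (toℕ i))
        ≈⟨ *-congˡ (*-congʳ (pow-+ a (N ∸ toℕ i) (toℕ i))) ⟨
      - r i * (pow R a (N ∸ toℕ i +ℕ toℕ i) * s (toℕ i))
        ≡⟨ ≡.cong (λ e → - r i * (pow R a e * s (toℕ i))) (m∸n+n≡m (toℕ≤n i)) ⟩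
      - r i * (pow R a N * s (toℕ i))
        ≈⟨ -‿distribˡ-* ring _ _ ⟨
      - (r i * (pow R a N * s (toℕ i)))
        ≈⟨ -‿cong (solve 3 (λ r q s → r :* (q :* s) := q :* (r :* s)) refl (r i) _ _) ⟩
      - (pow R a N * (r i * s (toℕ i))) ∎

  -- Finite quotients

  finite-transversal : ∀ P n (f : Fin n → A) → Σ ℕ λ m → Σ (Fin m → A) λ g →
    (∀ i → Σ (Fin m) λ j → f i - g j ∈ P) × (∀ i j → g i - g j ∈ P → i ≡ j)
  finite-transversal P zero    f = 0 , (λ ()) , (λ ()) , (λ ())
  finite-transversal P (suc n) f with finite-transversal P n (f ∘ suc)
  ... | m , g , cover , inj with excluded-middle (Σ (Fin m) λ j → f zero - g j ∈ P)
  ... | yes h = m , g , (λ { zero → h ; (suc i) → cover i }) , inj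
  ... | no new = suc m , (λ { zero → f zero ; (suc j) → g j }) ,
    (λ { zero → zero , ∈-refl P ; (suc i) → let j , h = cover i in suc j , h }) ,
    (λ { zero zero _ → ≡.refl
       ; zero (suc j) h → ⊥-elim (new (j , h))
       ; (suc i) zero h → ⊥-elim (new (i , ∈-swap P h))
       ; (suc i) (suc j) h → ≡.cong suc (inj i j h) })

  quotient-finite : ∀ I P → I ⊆ P → FiniteQuotient R I → FiniteQuotient R P
  quotient-finite I P I⊆P (n , f , cover , _) with finite-transversal P n f
  ... | m , g , cover′ , inj = m , g ,
    (λ x → let i , h = cover x ; j , k = cover′ i in j , ∈-trans P (I⊆P _ h) k) , inj

  -- Pigeonhole: if `f` met all `m` classes, choosing a hit for each would inject `Fin m` into
  -- `Fin k`.
  uncovered-class : ∀ P {m} → HasSize R P m → ∀ {k} → k < m → (f : Fin k → A) →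
    Σ A λ z → ∀ j → ¬ z - f j ∈ P
  uncovered-class P {m} (g , cover , inj) {k} k<m f = stable λ none →
    let hit : ∀ i → Σ (Fin k) λ j → g i - f j ∈ P
        hit i = stable λ miss → none (g i , λ j h → miss (j , h))
    in <⇒≱ k<m (injective⇒≤ {f = proj₁ ∘ hit} λ {i} {j} eq → inj i j
         (∈-trans P (proj₂ (hit i)) (≡.subst (λ t → f t - g j ∈ P) (≡.sym eq) (∈-swap P (proj₂ (hit j))))))

  -- Prime avoidance and the Chinese remainder theorem

  -- Multiply one witness outside `P` from each `Q l`; primality keeps the product outside `P`.
  separating-element : ∀ P → IsPrimeIdeal R P → ∀ N (Q : Fin N → Ideal R) → (∀ l → ¬ Q l ⊆ P) →
    Σ A λ d → (∀ l → d ∈ Q l) × ¬ d ∈ P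
  separating-element P (proper , prime) zero    Q Q⊈P = 1# , (λ ()) , proper
  separating-element P (proper , prime) (suc N) Q Q⊈P with separating-element P (proper , prime) N (Q ∘ suc) (Q⊈P ∘ suc)
  ... | d , d∈ , d∉P = e * d ,
    (λ { zero → resp (isIdeal (Q zero)) (*-comm d e) (*∈ (isIdeal (Q zero)) d e∈) ; (suc l) → *∈ (isIdeal (Q (suc l))) e (d∈ l) }) ,
    λ h → [ e∉P , d∉P ]′ (prime e d h)
    where
    witness : Σ A λ e → e ∈ Q zero × ¬ e ∈ P
    witness = stable λ none → Q⊈P zero λ e e∈ → stable λ e∉P → none (e , e∈ , e∉P)
    e : A
    e = proj₁ witness
    e∈ : e ∈ Q zero
    e∈ = proj₁ (proj₂ witness)
    e∉P : ¬ e ∈ P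
    e∉P = proj₂ (proj₂ witness)

  -- If x already avoids the classes of f modulo the later primes but not
  -- modulo the first one, P, then P differs from the later primes, so
  -- the Chinese remainder theorem replaces the class of x modulo P alone.
  simultaneous-avoidance : ∀ {k} (f : Fin k → A) N (Q : Fin N → Ideal R) →
    (∀ l → IsPrimeIdeal R (Q l)) → (∀ l → IsMaximalIdeal R (Q l)) →
    (∀ l → Σ A λ z → ∀ j → ¬ z - f j ∈ Q l) → Σ A λ x → ∀ l j → ¬ x - f j ∈ Q l
  simultaneous-avoidance f zero    Q prime maximal local = 0# , λ ()
  simultaneous-avoidance {k} f (suc N) Q prime maximal local
    with simultaneous-avoidance f N (Q ∘ suc) (prime ∘ suc) (maximal ∘ suc) (local ∘ suc)
  ... | x , avoids with excluded-middle (Lift (c ⊔ ℓ) (Σ (Fin k) λ j → x - f j ∈ Q zero))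
  ... | no good = x , λ { zero j h → good (lift (j , h)) ; (suc l) → avoids l }
  ... | yes (lift (j₀ , bad)) = x′ , λ
    { zero j h    → proj₂ (local zero) j (∈-trans P (∈-swap P x′-z∈P) h)
    ; (suc l) j h → avoids l j (∈-trans (Q (suc l)) (∈-swap (Q (suc l)) (x′-x∈Q l)) h) }
    where
    P : Ideal R
    P = Q zero
    z : A
    z = proj₁ (local zero)
    Q⊈P : ∀ l → ¬ Q (suc l) ⊆ P
    -- Maximality of `Q (suc l)` would turn the inclusion into equality, and the bad congruence
    -- modulo `P` would hold modulo `Q (suc l)` too.
    Q⊈P l Q⊆P = [ (λ P⊆Q → avoids l j₀ (P⊆Q _ bad)) , proj₁ (prime zero) ]′ (proj₂ (maximal (suc l)) P Q⊆P)
    separated : Σ A λ d → (∀ l → d ∈ Q (suc l)) × ¬ d ∈ P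
    separated = separating-element P (prime zero) N (Q ∘ suc) Q⊈P
    d : A
    d = proj₁ separated
    comax : 1# ∈ adjoin P d
    comax = maximal-comax P (maximal zero) (proj₂ (proj₂ separated))
    p r w x′ : A
    p = proj₁ comax
    r = proj₁ (proj₂ comax)
    w = r * d
    x′ = p * x + w * z
    1≈p+w : 1# ≈ p + w
    1≈p+w = proj₂ (proj₂ (proj₂ comax))
    x′-x∈Q : ∀ l → x′ - x ∈ Q (suc l)
    x′-x∈Q l = resp (isIdeal (Q (suc l))) (trans (*-comm (z - x) w) (sym (interpolation-diff 1≈p+w x z)))
      (*∈ (isIdeal (Q (suc l))) (z - x) (*∈ (isIdeal (Q (suc l))) r (proj₁ (proj₂ separated) l)))
    x′-z∈P : x′ - z ∈ P
    x′-z∈P = resp (isIdeal P)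
      (trans (*-comm (x - z) p) (trans (sym (interpolation-diff (trans 1≈p+w (+-comm p w)) z x)) (+-congʳ (+-comm (w * z) (p * x)))))
      (*∈ (isIdeal P) (x - z) (proj₁ (proj₂ (proj₂ comax))))

-- Dedekind domains: primes as colon ideals, and divisibility

module DedekindDomain {c ℓ} (R : CommutativeRing c ℓ) (dedekind : IsDedekindDomain R) where
  open CommutativeRing R hiding (zero) renaming (Carrier to A)
  open RingLemmas R
  open NoetherianDomain R (proj₁ dedekind) (proj₁ (proj₂ dedekind))
  open import Relation.Binary.Reasoning.Setoid setoid
  open NaturalCoefficients commutativeSemiring using (solve; _:=_; _:*_)
  open IsIdeal

  integrally-closed : IsIntegrallyClosed R
  integrally-closed = proj₁ (proj₂ (proj₂ dedekind))

  prime⇒maximal : ∀ I P → NonzeroIdeal R I → I ⊆ P → IsPrimeIdeal R P → IsMaximalIdeal R P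
  prime⇒maximal I P (a , a∈ , a≉0) I⊆P prime = proj₂ (proj₂ (proj₂ dedekind)) P prime (a , I⊆P a a∈ , a≉0)

  -- Avoiding the complement of `P` yields a prime `colon I y` inside `P`; it contains the nonzero
  -- `I`, so it is maximal and equals `P`.
  prime⇒colon : ∀ I P → NonzeroIdeal R I → IsPrimeIdeal R P → I ⊆ P →
    Σ A λ y → IsPrimeIdeal R (colon I y) × colon I y ⊆ P × P ⊆ colon I y
  prime⇒colon I P I≠0 (proper , prime) I⊆P with prime-colon-avoiding I (λ s → ¬ s ∈ P) proper
    (λ s t s∉ t∉ st∈ → [ s∉ , t∉ ]′ (prime s t st∈)) (λ s s∉ s∈I → s∉ (I⊆P s s∈I))
  ... | y , prime-y , disjoint = y , prime-y , colon⊆P ,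
    [ (λ P⊆colon → P⊆colon) , (λ 1∈P → ⊥-elim (proper 1∈P)) ]′
      (proj₂ (prime⇒maximal I (colon I y) I≠0 (⊆colon I y) prime-y) P colon⊆P)
    where
    colon⊆P : colon I y ⊆ P
    colon⊆P x h = stable λ x∉P → disjoint x x∉P h

  -- Write P = (a : b).  Since b / a is not in R, it does not stabilise P,
  -- so p b = t a for some p ∈ P and t ∉ P, whence 1 = p₀ + s t and
  -- P (a , b) = (a).
  comaximal-multiplier : ∀ P → IsPrimeIdeal R P → ∀ a → a ∈ P → ¬ a ≈ 0# → Σ A λ b →
    (∀ x → x ∈ P → Σ A λ y → x * b ≈ y * a) ×
    Σ A λ p₀ → Σ A λ p₁ → Σ A λ w → p₀ ∈ P × p₁ ∈ P × 1# ≈ p₀ + w × p₁ * b ≈ w * a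
  comaximal-multiplier P prime a a∈ a≉0 with prime⇒colon (principal a) P (a , (1# , sym (*-identityˡ a)) , a≉0) prime
    (λ { x (r , h) → resp (isIdeal P) (sym h) (*∈ (isIdeal P) r a∈) })
  ... | b , _ , colon⊆P , P⊆colon = b , P⊆colon ,
    (let p , p∈ , t , t∉ , h = escape
         p₀ , s , p₀∈ , 1≈ = maximal-comax P (prime⇒maximal P P (a , a∈ , a≉0) (λ _ x∈ → x∈) prime) t∉
     in p₀ , s * p , s * t , p₀∈ , *∈ (isIdeal P) s p∈ , 1≈ ,
        trans (*-assoc s p b) (trans (*-congˡ h) (sym (*-assoc s t a))))
    where
    escape : Σ A λ p → p ∈ P × Σ A λ t → ¬ t ∈ P × p * b ≈ t * a
    escape = stable λ none →
      let r , b≈ar = integrally-closed b a a≉0 (stable-multiplier⇒integral P (a , a∈ , a≉0) a b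
            λ x x∈ → let t , h = P⊆colon x x∈ in t , stable (λ t∉ → none (x , x∈ , t , t∉ , h)) , h)
      -- If `b` were a multiple of `a`, then 1 would lie in (a : b), which is `P`.
      in proj₁ prime (colon⊆P 1# (r , trans (*-identityˡ b) (trans b≈ar (*-comm a r))))

  -- The cofactor of P is (I : P): with b as above, x ∈ I and b x = z a
  -- give x = p₀ x + p₁ z, and z P ⊆ I because z q = (b q / a) x for q ∈ P.
  prime-⊇⇒divides : ∀ I P → NonzeroIdeal R I → IsPrimeIdeal R P → I ⊆ P → Divides R P I
  prime-⊇⇒divides I P (a , a∈I , a≉0) prime I⊆P = colonIdeal I P , I⊆product , product⊆I
    where
    multiplier : Σ A λ b → (∀ x → x ∈ P → Σ A λ y → x * b ≈ y * a) ×
      Σ A λ p₀ → Σ A λ p₁ → Σ A λ w → p₀ ∈ P × p₁ ∈ P × 1# ≈ p₀ + w × p₁ * b ≈ w * a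
    multiplier = comaximal-multiplier P prime a (I⊆P a a∈I) a≉0
    -- Both sides are `x * q` times the fraction b / a.
    cross : ∀ b x z q t → x * b ≈ z * a → q * b ≈ t * a → t * x ≈ q * z
    cross b x z q t xb≈za qb≈ta = *-cancelʳ a≉0 (begin
      (t * x) * a     ≈⟨ solve 3 (λ t x a → (t :* x) :* a := x :* (t :* a)) refl t x a ⟩
      x * (t * a)     ≈⟨ *-congˡ qb≈ta ⟨
      x * (q * b)     ≈⟨ solve 3 (λ x q b → x :* (q :* b) := q :* (x :* b)) refl x q b ⟩
      q * (x * b)     ≈⟨ *-congˡ xb≈za ⟩
      q * (z * a)     ≈⟨ *-assoc q z a ⟨
      (q * z) * a     ∎)
    I⊆product : ∀ x → x ∈ I → ProdMem R P (colonIdeal I P) x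
    I⊆product x x∈ =
      let b , bP⊆aR , p₀ , p₁ , w , p₀∈ , p₁∈ , 1≈ , p₁b≈wa = multiplier
          z , xb≈za = bP⊆aR x (I⊆P x x∈)
      in (p₀ , x) ∷ (p₁ , z) ∷ [] ,
        (p₀∈ , λ q _ → *∈ (isIdeal I) q x∈) ∷
        (p₁∈ , λ q q∈ → let t , qb≈ta = bP⊆aR q q∈ in
          resp (isIdeal I) (cross b x z q t xb≈za qb≈ta) (*∈ (isIdeal I) t x∈)) ∷ [] ,
        (begin
          x                         ≈⟨ *-identityˡ x ⟨
          1# * x                    ≈⟨ *-congʳ 1≈ ⟩
          (p₀ + w) * x              ≈⟨ distribʳ x p₀ w ⟩
          p₀ * x + w * x            ≈⟨ +-congˡ (cross b x z p₁ w xb≈za p₁b≈wa) ⟩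
          p₀ * x + p₁ * z           ≈⟨ +-congˡ (+-identityʳ _) ⟨
          p₀ * x + (p₁ * z + 0#)    ∎)
    sumProds∈ : ∀ ps → All (λ pq → proj₁ pq ∈ P × proj₂ pq ∈ colonIdeal I P) ps → sumProds R ps ∈ I
    sumProds∈ []             []                 = zero∈ (isIdeal I)
    sumProds∈ ((p , q) ∷ ps) ((p∈ , q∈) ∷ rest) = +∈ (isIdeal I) (q∈ p p∈) (sumProds∈ ps rest)
    product⊆I : ∀ x → ProdMem R P (colonIdeal I P) x → x ∈ I
    product⊆I x (ps , all , h) = resp (isIdeal I) (sym h) (sumProds∈ ps all)

  -- The finitely many primes over `I` and the units modulo `I`

  module _ (I : Ideal R) (I≠0 : NonzeroIdeal R I) (finite : FiniteQuotient R I) (nontrivial : NontrivialQuotient R I) where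
    n : ℕ
    n = proj₁ finite

    rep : Fin n → A
    rep = proj₁ (proj₂ finite)

    class : A → Fin n
    class x = proj₁ (proj₁ (proj₂ (proj₂ finite)) x)

    class-rep : ∀ x → x - rep (class x) ∈ I
    class-rep x = proj₂ (proj₁ (proj₂ (proj₂ finite)) x)

    PrimeOver : Set _
    PrimeOver = Σ (Ideal R) λ P → IsPrimeIdeal R P × I ⊆ P

    some-prime : ∀ J → I ⊆ J → Proper R J → Σ PrimeOver λ P → J ⊆ proj₁ P
    some-prime J I⊆J proper with prime-colon J proper
    ... | y , prime = (colon J y , prime , λ x x∈ → ⊆colon J y x (I⊆J x x∈)) , ⊆colon J y

    prime-over : PrimeOver
    prime-over = proj₁ (some-prime I (λ _ x∈ → x∈)
      λ 1∈ → nontrivial (+∈ (isIdeal I) 1∈ (neg∈ I (zero∈ (isIdeal I)))))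

    -- Every prime over I is (I : rep l) for some l; the remaining indices
    -- are filled with an arbitrary prime over I.
    choose : ∀ l → Dec (IsPrimeIdeal R (colon I (rep l))) → PrimeOver
    choose l (yes prime) = colon I (rep l) , prime , ⊆colon I (rep l)
    choose l (no _)      = prime-over

    primes : Fin n → PrimeOver
    primes l = choose l (excluded-middle _)

    Q : Fin n → Ideal R
    Q = proj₁ ∘ primes

    Q-prime : ∀ l → IsPrimeIdeal R (Q l)
    Q-prime l = proj₁ (proj₂ (primes l))

    I⊆Q : ∀ l → I ⊆ Q l
    I⊆Q l = proj₂ (proj₂ (primes l))

    -- `P` is (I : y) for some `y`, and this ideal depends only on `y` modulo `I`, so the
    -- representative of `y` gives it as well.
    primes-complete : ∀ ((P , _) : PrimeOver) → Σ (Fin n) λ l → P ⊆ Q l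
    primes-complete (P , prime , I⊆P) with prime⇒colon I P I≠0 prime I⊆P
    ... | y , (proper , prime-y) , _ , P⊆colon = class y , chosen (excluded-middle _)
      where
      J : Ideal R
      J = colon I (rep (class y))
      to : colon I y ⊆ J
      to = colon-cong I (class-rep y)
      from : J ⊆ colon I y
      from = colon-cong I (∈-swap I (class-rep y))
      J-prime : IsPrimeIdeal R J
      J-prime = (λ h → proper (from 1# h)) ,
        λ a b h → [ inj₁ ∘ to a , inj₂ ∘ to b ]′ (prime-y a b (from (a * b) h))
      -- A general decision `d` lets `choose` reduce by matching on it.
      chosen : ∀ d → P ⊆ proj₁ (choose (class y) d)
      chosen (yes _)    x x∈ = to x (P⊆colon x x∈)
      chosen (no ¬prime) = ⊥-elim (¬prime J-prime)

    -- If `adjoin I x` were proper, a prime over it would contain `x` and be included in some `Q l`.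
    -- So 1 = i + r x with i in `I`, and `r` inverts `x`.
    unit-criterion : ∀ x → (∀ l → ¬ x ∈ Q l) → IsUnitMod R I x
    unit-criterion x x∉Q =
      let i , r , i∈ , 1≈ = stable proper-impossible
      in r , ∈-swap I (resp (isIdeal I) (sym (≈sum⇒diff≈ (trans 1≈ (trans (+-comm i _) (+-congʳ (*-comm r x)))))) i∈)
      where
      proper-impossible : ¬ Proper R (adjoin I x)
      proper-impossible proper =
        let P , ⊆P = some-prime (adjoin I x) (⊆adjoin I x) proper
            l , P⊆Q = primes-complete P
        in x∉Q l (P⊆Q x (⊆P x (∈adjoin I x)))

    -- The least residue field and a clique of its size

    size : Fin n → ℕ
    size l = proj₁ (quotient-finite I (Q l) (I⊆Q l) finite)

    Q-size : ∀ l → HasSize R (Q l) (size l)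
    Q-size l = proj₂ (quotient-finite I (Q l) (I⊆Q l) finite)

    smallest : Fin n
    -- `argmin` needs a default index; `class 0#` shows that `Fin n` is inhabited.
    smallest = argmin size (class 0#) (allFin n)

    smallest-≤ : ∀ l → size smallest ≤ size l
    smallest-≤ l = lookup (f[argmin]≤f[xs] (class 0#) (allFin n)) (∈-allFin l)

    Separated : ∀ {k} → (Fin k → A) → Set _
    Separated f = ∀ i j → ¬ i ≡ j → ∀ l → ¬ f i - f j ∈ Q l

    separated-family : ∀ k → k ≤ size smallest → Σ (Fin k → A) Separated
    separated-family zero    _   = (λ ()) , λ ()
    separated-family (suc k) k<q = extended , λ
      { zero    zero    i≢j → ⊥-elim (i≢j ≡.refl)
      ; zero    (suc j) _   l → proj₂ new l j
      ; (suc i) zero    _   l h → proj₂ new l i (∈-swap (Q l) h)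
      ; (suc i) (suc j) i≢j → proj₂ previous i j (i≢j ∘ ≡.cong suc) }
      where
      previous : Σ (Fin k → A) Separated
      previous = separated-family k (<⇒≤ k<q)
      f : Fin k → A
      f = proj₁ previous
      new : Σ A λ x → ∀ l j → ¬ x - f j ∈ Q l
      new = simultaneous-avoidance f n Q Q-prime
        (λ l → prime⇒maximal I (Q l) I≠0 (I⊆Q l) (Q-prime l))
        -- `k` is below the least size, hence below every `size l`.
        (λ l → uncovered-class (Q l) (Q-size l) (≤-trans k<q (smallest-≤ l)) f)
      extended : Fin (suc k) → A
      extended zero    = proj₁ new
      extended (suc j) = f j

    clique : HasClique R I (size smallest)
    clique = let f , separated = separated-family (size smallest) ≤-refl in
      f , λ i j i≢j →
        (λ h → separated i j i≢j smallest (I⊆Q smallest _ h)) , unit-criterion _ (separated i j i≢j)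

    colouring : HasColouring R I (size smallest)
    colouring = prime⇒colouring (Q smallest) I (Q-prime smallest) (I⊆Q smallest) (Q-size smallest)

    clique-chromatic : Σ ℕ λ q → IsQ R I q × CliqueNumber R I q × ChromaticNumber R I q
    clique-chromatic = size smallest ,
      ( (Q smallest , Q-prime smallest , prime-⊇⇒divides I (Q smallest) I≠0 (Q-prime smallest) (I⊆Q smallest) , Q-size smallest)
      -- Rather than locating `P` among the `Q l`, compare the clique with the colouring that `P`
      -- induces.
      , λ P m prime P∣I P-size → clique≤colouring I clique (prime⇒colouring P I prime (divides⇒⊇ P I P∣I) P-size)) ,
      (clique , λ m K → clique≤colouring I K colouring) ,
      (colouring , λ m C → clique≤colouring I clique C)

theorem4p3 : ∀ {c ℓ} (R : CommutativeRing c ℓ) → IsDedekindDomain R →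
    (I : Ideal R) → NonzeroIdeal R I → FiniteQuotient R I → NontrivialQuotient R I →
    Σ ℕ λ q → IsQ R I q × CliqueNumber R I q × ChromaticNumber R I q
theorem4p3 R dedekind = DedekindDomain.clique-chromatic R dedekind
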